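{- Let $n$ and $\ell$ be positive integers with $\frac{n}{2}\leq \ell\leq n-3$. Then $$t(n,3,\ell)\leq 2n-\ell-1.$$
   Context: All graphs are finite, undirected and simple. Let $G$ be a nontrivial connected graph of order $n$ (i.e. with $n$ vertices). An edge-coloring of $G$ is any assignment of colors to the edges (adjacent edges may receive the same color). A tree $T$ that is a subgraph of $G$ is a rainbow tree if no two edges of $T$ have the same color. For $S\subseteq V(G)$ with $|S|\geq 2$, a rainbow $S$-tree is a rainbow tree $T$ in $G$ with $S\subseteq V(T)$. For an integer $k$ with $2\leq k\leq n$, an edge-coloring of $G$ is a $k$-rainbow coloring if for every $k$-subset $S$ of $V(G)$ there exists a rainbow $S$-tree. The $k$-rainbow index $rx_k(G)$ is the minimum number of colors needed in a $k$-rainbow coloring of $G$. For integers $2\leq k\leq n$ and $2\leq\ell\leq n-1$, $t(n,k,\ell)$ denotes the minimum size (number of edges) of a connected graph $G$ of order $n$ with $rx_k(G)\leq \ell$ (when such a graph exists). -}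

module Defs where

open import Data.Nat using (ℕ; _≤_; _+_)
open import Data.Fin using (Fin; zero; suc; inject₁; fromℕ; _<_)
open import Data.Fin.Subset using (Subset; _∈_; _⊆_; ∣_∣; ⊤; Nonempty)
open import Data.Fin.Subset.Properties using (∈⊤)
open import Data.Product using (Σ; ∃-syntax; _×_; _,_)
open import Data.Sum using (_⊎_)
open import Function.Definitions using (Injective)
open import Relation.Binary.Construct.Closure.ReflexiveTransitive using (Star)
open import Relation.Binary.PropositionalEquality using (_≡_)
open import Relation.Nullary using (¬_)

-- A simple graph with vertex set Fin n whose edges are enumerated by Fin size.
-- Listing the smaller endpoint first excludes loops and gives each unordered
-- pair a single name, so `simple` says that there are no parallel edges.
record Graph (n : ℕ) : Set where
  field
    size    : ℕ
    src tgt : Fin size → Fin n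
    src<tgt : ∀ e → src e < tgt e
    simple  : ∀ {e f} → src e ≡ src f → tgt e ≡ tgt f → e ≡ f

open Graph public using (size)

record Subgraph {n : ℕ} (G : Graph n) : Set where
  open Graph G using (src; tgt)
  field
    V      : Subset n
    E      : Subset (size G)
    closed : ∀ {e} → e ∈ E → src e ∈ V × tgt e ∈ V

module _ {n : ℕ} {G : Graph n} where
  open Graph G using (src; tgt)

  Joins : Fin (size G) → Fin n → Fin n → Set
  Joins e u v = (src e ≡ u × tgt e ≡ v) ⊎ (src e ≡ v × tgt e ≡ u)

  Adjacent : Subgraph G → Fin n → Fin n → Set
  Adjacent H u v = ∃[ e ] e ∈ Subgraph.E H × Joins e u v

  Connected : Subgraph G → Set
  Connected H = Nonempty V × (∀ {u v} → u ∈ V → v ∈ V → Star (Adjacent H) u v)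
    where open Subgraph H using (V)

  -- The cycle visits the distinct vertices vertex 0, …, vertex (2 + m) in order
  -- and returns to vertex 0; its length 3 + m is at least three.
  record Cycle (H : Subgraph G) : Set where
    field
      m         : ℕ
      vertex    : Fin (3 + m) → Fin n
      injective : Injective _≡_ _≡_ vertex
      step      : ∀ i → Adjacent H (vertex (inject₁ i)) (vertex (suc i))
      close     : Adjacent H (vertex (fromℕ (2 + m))) (vertex zero)

  IsTree : Subgraph G → Set
  IsTree H = Connected H × ¬ Cycle H

whole : ∀ {n} (G : Graph n) → Subgraph G
whole G = record { V = ⊤ ; E = ⊤ ; closed = λ _ → ∈⊤ , ∈⊤ }

ConnectedGraph : ∀ {n} → Graph n → Set
ConnectedGraph G = Connected (whole G)

-- The palette is Fin c; colours may be left unused, which does not affect the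
-- minimum number of colours.
Colouring : ∀ {n} → Graph n → ℕ → Set
Colouring G c = Fin (size G) → Fin c

module _ {n : ℕ} {G : Graph n} {c : ℕ} (χ : Colouring G c) where

  Rainbow : Subgraph G → Set
  Rainbow H = ∀ {e f} → e ∈ E → f ∈ E → χ e ≡ χ f → e ≡ f
    where open Subgraph H using (E)

  RainbowSTree : Subset n → Subgraph G → Set
  RainbowSTree S T = IsTree T × Rainbow T × S ⊆ Subgraph.V T

  IsRainbowColouring : ℕ → Set
  IsRainbowColouring k = (S : Subset n) → ∣ S ∣ ≡ k → ∃[ T ] RainbowSTree S T

IsMinimum : (ℕ → Set) → ℕ → Set
IsMinimum P m = P m × (∀ j → P j → m ≤ j)

-- IsRx k G r says rx_k(G) = r.
IsRx : ∀ {n} → ℕ → Graph n → ℕ → Set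
IsRx k G = IsMinimum (λ c → ∃[ χ ] IsRainbowColouring {G = G} {c = c} χ k)

Rx≤ : ∀ {n} → ℕ → Graph n → ℕ → Set
Rx≤ k G ℓ = ∃[ r ] IsRx k G r × r ≤ ℓ

-- IsT n k ℓ t says t(n,k,ℓ) = t, and in particular that the minimum exists.
IsT : ℕ → ℕ → ℕ → ℕ → Set
IsT n k ℓ =
  IsMinimum (λ m → Σ (Graph n) λ G → ConnectedGraph G × Rx≤ k G ℓ × size G ≡ m)

{-# OPTIONS --safe #-}

-- Put k = n − ℓ ≤ ℓ.  Take k − 1 four-cycles p v w q sharing the edge pq of
-- colour a; in each of them pv and qw get one new colour and vw gets colour a.
-- Then attach ℓ − k pendant edges of further new colours.  This graph has n
-- vertices, ℓ colours and only 2n − ℓ − 2 edges.  Adding a page keeps all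
-- triples spanned by rainbow trees: a triple with at most one of v, w reduces
-- to an old one with p or q in its place, and for {v, w, x} a rainbow tree
-- through x and one of p, q that avoids colour a extends by a new-coloured
-- edge and vw.  All notions involved being decidable, an upper bound that is
-- attained yields the minimum.
module Submission where

open import Defs
open import Data.Nat using (ℕ; zero; suc; _≤_; _+_; _*_; _∸_; s≤s; s≤s⁻¹)
import Data.Nat as ℕ
import Data.Nat.Properties as ℕ
open import Data.Nat.Induction using (<-wellFounded)
open import Data.Nat.Tactic.RingSolver using (solve-∀)
open import Induction.WellFounded using (Acc; acc)
open import Data.Fin using (Fin; zero; suc; toℕ; fromℕ; fromℕ<; inject₁; finToFun; funToFin)
import Data.Fin as Fin
open import Data.Fin.Properties
  using (_≟_; _<?_; any?; all?; toℕ<n; toℕ-injective; toℕ-fromℕ<; toℕ-inject₁; suc-injective;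
         finToFun-funToFin; injective⇒≤)
open import Data.Fin.Subset using (Subset; Nonempty; inside; outside; _∈_; _∉_; _⊆_; _∪_; ⊥; ⁅_⁆; ∣_∣)
open import Data.Fin.Subset.Properties
  using (_∈?_; _⊆?_; anySubset?; nonempty?; ∉⊥; x∈⁅x⁆; x∈⁅y⁆⇒x≡y; x∈p∪q⁻; x∈p∪q⁺;
         ∪-identityˡ; ∣p∣≤∣x∷p∣; s⊆s; out⊆; drop-there; ∈⊤; ∣⁅x⁆∣≡1)
open import Data.Fin.Relation.Unary.Top using (view; ‵fromℕ; ‵inject₁)
open import Data.Product using (Σ; Σ-syntax; ∃; ∃-syntax; _×_; _,_; proj₁; proj₂)
open import Data.Sum using (_⊎_; inj₁; inj₂) renaming (map to map⊎)
open import Data.Vec using ([]; _∷_; here; there)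
import Data.Vec.Functional as Vector
open import Function using (_∘_)
open import Function.Definitions using (Injective)
open import Relation.Binary using (Rel; Decidable)
open import Relation.Binary.Construct.Closure.ReflexiveTransitive
  using (Star; ε; _◅_; _◅◅_; gmap; reverse)
open import Relation.Binary.PropositionalEquality
open import Relation.Nullary using (¬_; Dec; yes; no; contradiction)
open import Relation.Nullary.Decidable
  using (map′; _×-dec_; _⊎-dec_; _→-dec_; ¬?; decidable-stable)
open import Level using (0ℓ)

-- Decidability of the graph-theoretic notions

-- Well-founded descent: a witness below `m` restarts the search there, and if there is none then
-- `m` is minimal. It supplies the minima demanded by `IsRx` and `IsT`.
least : {P : ℕ → Set} → (∀ m → Dec (P m)) → ∀ {m} → P m → ∃[ j ] IsMinimum P j × j ≤ m
least {P} P? {m} = go m (<-wellFounded m)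
  where
  go : ∀ m → Acc ℕ._<_ m → P m → ∃[ j ] IsMinimum P j × j ≤ m
  go m (acc rs) p with ℕ.anyUpTo? P? m
  ... | yes (i , i<m , q) with go i (rs i<m) q
  ...   | j , min , j≤i = j , min , ℕ.≤-trans j≤i (ℕ.<⇒≤ i<m)
  go m (acc rs) p | no none =
    m , (p , λ j q → ℕ.≮⇒≥ λ j<m → none (j , j<m , q)) , ℕ.≤-refl

-- Functions between finite sets are coded by numbers, which are searched. Decoding recovers a
-- function only up to pointwise equality, so `P` has to respect it.
anyFunction? : ∀ {m n} {P : (Fin m → Fin n) → Set} →
  (∀ {f g} → f ≗ g → P f → P g) → (∀ f → Dec (P f)) → Dec (∃ P)
anyFunction? resp P? = map′
  (λ (i , p) → finToFun i , p)
  (λ (f , p) → funToFin f , resp (sym ∘ finToFun-funToFin f) p)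
  (any? (P? ∘ finToFun))

allSubsets? : ∀ {n} {P : Subset n → Set} → (∀ S → Dec (P S)) → Dec (∀ S → P S)
allSubsets? P? = map′
  (λ none S → decidable-stable (P? S) λ ¬p → none (S , ¬p))
  (λ all (S , ¬p) → ¬p (all S))
  (¬? (anySubset? (¬? ∘ P?)))

-- As in the Floyd–Warshall algorithm, the interior vertices of a Route R k
-- have index less than k.
Route : ∀ {n} → Rel (Fin n) 0ℓ → ℕ → Rel (Fin n) 0ℓ
Route R zero    u v = u ≡ v ⊎ R u v
Route R (suc k) u v = Route R k u v ⊎ ∃[ w ] toℕ w ≡ k × Route R k u w × Route R k w v

module _ {n : ℕ} {R : Rel (Fin n) 0ℓ} where

  route? : Decidable R → ∀ k → Decidable (Route R k)
  route? R? zero    u v = (u ≟ v) ⊎-dec R? u v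
  route? R? (suc k) u v = route? R? k u v ⊎-dec
    any? λ w → (toℕ w ℕ.≟ k) ×-dec route? R? k u w ×-dec route? R? k w v

  edge⇒route : ∀ k {u v} → R u v → Route R k u v
  edge⇒route zero    r = inj₂ r
  edge⇒route (suc k) r = inj₁ (edge⇒route k r)

  refl-route : ∀ k {u} → Route R k u u
  refl-route zero    = inj₁ refl
  refl-route (suc k) = inj₁ (refl-route k)

  private
    -- If the target `w` itself has index `k`, a route through the vertex of index `k` may stop at
    -- its first visit there.
    into : ∀ {k u w} → toℕ w ≡ k → Route R (suc k) u w → Route R k u w
    into eq (inj₁ p) = p
    into eq (inj₂ (x , eq′ , p , _)) with refl ← toℕ-injective (trans eq (sym eq′)) = p

    outOf : ∀ {k w v} → toℕ w ≡ k → Route R (suc k) w v → Route R k w v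
    outOf eq (inj₁ p) = p
    outOf eq (inj₂ (x , eq′ , _ , p)) with refl ← toℕ-injective (trans eq (sym eq′)) = p

  -- This transitivity lets `star⇒route` prepend one edge at a time: once `k` is `n`, every vertex
  -- qualifies as `w`.
  join-routes : ∀ k {u w v} → toℕ w ℕ.< k → Route R k u w → Route R k w v → Route R k u v
  join-routes (suc k) {w = w} w<1+k p q with ℕ.m≤n⇒m<n∨m≡n (s≤s⁻¹ w<1+k)
  ... | inj₂ eq = inj₂ (w , eq , into eq p , outOf eq q)
  ... | inj₁ w<k with p | q
  ...   | inj₁ p                 | inj₁ q                 = inj₁ (join-routes k w<k p q)
  ...   | inj₂ (x , eq , p , p′) | inj₁ q                 = inj₂ (x , eq , p , join-routes k w<k p′ q)
  ...   | inj₁ p                 | inj₂ (y , eq , q , q′) = inj₂ (y , eq , join-routes k w<k p q , q′)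
  -- Both routes visit the vertex of index `k`; the loop between the two visits is cut out.
  ...   | inj₂ (x , eq , p , _)  | inj₂ (y , eq′ , _ , q)
          with refl ← toℕ-injective (trans eq (sym eq′)) = inj₂ (x , eq , p , q)

  route⇒star : ∀ k {u v} → Route R k u v → Star R u v
  route⇒star zero    (inj₁ refl)            = ε
  route⇒star zero    (inj₂ r)               = r ◅ ε
  route⇒star (suc k) (inj₁ p)               = route⇒star k p
  route⇒star (suc k) (inj₂ (_ , _ , p , q)) = route⇒star k p ◅◅ route⇒star k q

  star⇒route : ∀ {u v} → Star R u v → Route R n u v
  star⇒route ε                 = refl-route n
  star⇒route (_◅_ {j = w} r s) = join-routes n (toℕ<n w) (edge⇒route n r) (star⇒route s)

  star? : Decidable R → Decidable (Star R)
  star? R? u v = map′ (route⇒star n) star⇒route (route? R? n u v)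

-- Invariance and decidability of trees and rainbow trees

module _ {n : ℕ} {G G′ : Graph n} {H : Subgraph G} {H′ : Subgraph G′} where
  open Subgraph

  transport-connected : V H ≡ V H′ → (∀ {u v} → Adjacent H u v → Adjacent H′ u v) →
    Connected H → Connected H′
  transport-connected V≡ f (ne , conn) =
    subst Nonempty V≡ ne ,
    λ u∈ v∈ → gmap (λ x → x) f (conn (subst (_ ∈_) (sym V≡) u∈) (subst (_ ∈_) (sym V≡) v∈))

  transport-cycle : (∀ {u v} → Adjacent H u v → Adjacent H′ u v) → Cycle H → Cycle H′
  transport-cycle f c = record
    { m = m ; vertex = vertex ; injective = injective ; step = f ∘ step ; close = f close }
    where open Cycle c

-- Being a tree depends only on the vertex set and the adjacency relation. This covers subgraphs
-- that differ in their `closed` proofs and graphs whose endpoint functions agree pointwise. Cycles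
-- travel backwards, hence the need for both directions.
transport-tree : ∀ {n} {G G′ : Graph n} {H : Subgraph G} {H′ : Subgraph G′} →
  Subgraph.V H ≡ Subgraph.V H′ →
  (∀ {u v} → Adjacent H u v → Adjacent H′ u v) → (∀ {u v} → Adjacent H′ u v → Adjacent H u v) →
  IsTree H → IsTree H′
transport-tree {H = H} {H′} V≡ f g (conn , acyclic) =
  transport-connected {H = H} {H′} V≡ f conn , acyclic ∘ transport-cycle {H = H′} {H} g

module _ {n : ℕ} {G : Graph n} (H : Subgraph G) where
  open Graph G using (src; tgt)
  open Subgraph H

  adjacent? : Decidable (Adjacent H)
  adjacent? u v = any? λ e → (e ∈? E) ×-dec
    (((src e ≟ u) ×-dec (tgt e ≟ v)) ⊎-dec ((src e ≟ v) ×-dec (tgt e ≟ u)))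

  connected? : Dec (Connected H)
  connected? = nonempty? V ×-dec map′ (λ f {u} {v} → f u v) (λ f u v → f)
    (all? λ u → all? λ v → (u ∈? V) →-dec (v ∈? V) →-dec star? adjacent? u v)

  CycleThrough : ∀ m → (Fin (3 + m) → Fin n) → Set
  CycleThrough m vertex =
    (∀ i j → vertex i ≡ vertex j → i ≡ j) ×
    (∀ i → Adjacent H (vertex (inject₁ i)) (vertex (suc i))) ×
    Adjacent H (vertex (fromℕ (2 + m))) (vertex zero)

  cycleThrough-resp : ∀ {m f g} → f ≗ g → CycleThrough m f → CycleThrough m g
  cycleThrough-resp f≗g (inj , step , close) =
    (λ i j eq → inj i j (trans (f≗g i) (trans eq (sym (f≗g j))))) ,
    (λ i → subst₂ (Adjacent H) (f≗g _) (f≗g _) (step i)) ,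
    subst₂ (Adjacent H) (f≗g _) (f≗g _) close

  cycleThrough? : ∀ m vertex → Dec (CycleThrough m vertex)
  cycleThrough? m vertex =
    (all? λ i → all? λ j → (vertex i ≟ vertex j) →-dec (i ≟ j)) ×-dec
    (all? λ i → adjacent? _ _) ×-dec adjacent? _ _

  -- The vertices of a cycle are distinct, so 3 + m ≤ n, and only the finitely many lengths with m <
  -- n have to be searched.
  cycle? : Dec (Cycle H)
  cycle? = map′ to from
    (any? λ (i : Fin n) → anyFunction? (cycleThrough-resp {toℕ i}) (cycleThrough? (toℕ i)))
    where
    to : (∃[ i ] ∃ (CycleThrough (toℕ i))) → Cycle H
    to (i , vertex , inj , step , close) = record
      { m = toℕ i ; vertex = vertex ; injective = inj _ _ ; step = step ; close = close }

    from : Cycle H → ∃[ i ] ∃ (CycleThrough (toℕ i))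
    from c = fromℕ< m<n , subst (λ k → ∃ (CycleThrough k)) (sym (toℕ-fromℕ< m<n))
      (vertex , (λ _ _ → injective) , step , close)
      where
      open Cycle c
      m<n : m ℕ.< n
      m<n = ℕ.≤-trans (ℕ.m≤n+m (suc m) 2) (injective⇒≤ injective)

  tree? : Dec (IsTree H)
  tree? = connected? ×-dec ¬? cycle?

  rainbow? : ∀ {c} (χ : Colouring G c) → Dec (Rainbow χ H)
  rainbow? χ = map′ (λ f {e} {f′} → f e f′) (λ f e f′ → f)
    (all? λ e → all? λ f → (e ∈? E) →-dec (f ∈? E) →-dec (χ e ≟ χ f) →-dec (e ≟ f))

module _ {n : ℕ} (G : Graph n) where
  open Graph G using (src; tgt)

  Closed : Subset n → Subset (size G) → Set
  Closed V E = ∀ e → e ∈ E → src e ∈ V × tgt e ∈ V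

  closed? : ∀ V E → Dec (Closed V E)
  closed? V E = all? λ e → (e ∈? E) →-dec ((src e ∈? V) ×-dec (tgt e ∈? V))

module _ {n c : ℕ} (G : Graph n) (χ : Colouring G c) where

  rainbowSTree? : ∀ S → Dec (∃[ T ] RainbowSTree χ S T)
  rainbowSTree? S = map′ (λ (V , E , cl , t) → _ , t)
    (λ (T , t) → Subgraph.V T , Subgraph.E T , (λ _ → Subgraph.closed T) , t)
    (anySubset? λ V → anySubset? λ E → on V E)
    where
    On : Subset n → Subset (size G) → Set
    On V E = Σ[ cl ∈ Closed G V E ] RainbowSTree χ S (record { V = V ; E = E ; closed = cl _ })

    on : ∀ V E → Dec (On V E)
    on V E with closed? G V E
    ... | no ¬cl = no (¬cl ∘ proj₁)
    ... | yes cl = map′ (cl ,_)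
      -- A tree may come with a closure proof `cl′` other than `cl`; it is carried over to the
      -- subgraph `H` built from `cl`.
      (λ (cl′ , t , r , s) →
        transport-tree {H = record { V = V ; E = E ; closed = cl′ _ }} {H}
          refl (λ a → a) (λ a → a) t , r , s)
      (tree? H ×-dec rainbow? H χ ×-dec (S ⊆? V))
      where
      H : Subgraph G
      H = record { V = V ; E = E ; closed = cl _ }

  rainbowColouring? : ∀ k → Dec (IsRainbowColouring χ k)
  rainbowColouring? k = allSubsets? λ S → (∣ S ∣ ℕ.≟ k) →-dec rainbowSTree? S

-- Search over colourings and over graphs of given size

module _ {n m : ℕ} where

  Ordered : (s t : Fin m → Fin n) → Set
  Ordered s t = ∀ e → s e Fin.< t e

  NoParallel : (s t : Fin m → Fin n) → Set
  NoParallel s t = ∀ e f → s e ≡ s f → t e ≡ t f → e ≡ f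

  -- Exposing the endpoint functions turns the search for a graph of size `m` into a search for two
  -- functions.
  graph : (s t : Fin m → Fin n) → Ordered s t → NoParallel s t → Graph n
  graph s t ord simp = record { size = m ; src = s ; tgt = t ; src<tgt = ord ; simple = simp _ _ }

  module _ {s t s′ t′ : Fin m → Fin n} (s≗ : s ≗ s′) (t≗ : t ≗ t′)
    (ord : Ordered s t) (simp : NoParallel s t) (ord′ : Ordered s′ t′) (simp′ : NoParallel s′ t′)
    where

    private
      G G′ : Graph n
      G  = graph s t ord simp
      G′ = graph s′ t′ ord′ simp′

    transport-joins : ∀ {e u v} → Joins {G = G} e u v → Joins {G = G′} e u v
    transport-joins (inj₁ (p , q)) = inj₁ (trans (sym (s≗ _)) p , trans (sym (t≗ _)) q)
    transport-joins (inj₂ (p , q)) = inj₂ (trans (sym (s≗ _)) p , trans (sym (t≗ _)) q)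

    transport-connectedGraph : ConnectedGraph G → ConnectedGraph G′
    transport-connectedGraph = transport-connected {H = whole G} {whole G′} refl
      λ (e , e∈ , j) → e , e∈ , transport-joins j

  transport-rainbowColouring : ∀ {c k} {s t s′ t′ : Fin m → Fin n} {χ χ′ : Fin m → Fin c} →
    (s≗ : s ≗ s′) (t≗ : t ≗ t′) → χ ≗ χ′ →
    (ord : Ordered s t) (simp : NoParallel s t) (ord′ : Ordered s′ t′) (simp′ : NoParallel s′ t′) →
    IsRainbowColouring {G = graph s t ord simp} χ k →
    IsRainbowColouring {G = graph s′ t′ ord′ simp′} χ′ k
  transport-rainbowColouring s≗ t≗ χ≗ ord simp ord′ simp′ rc S ∣S∣≡k with rc S ∣S∣≡k
  ... | T , tree , rainbow , S⊆ = T′ ,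
    transport-tree {H = T} {T′} refl
      (λ (e , e∈ , j) → e , e∈ , transport-joins s≗ t≗ ord simp ord′ simp′ j)
      (λ (e , e∈ , j) →
        e , e∈ , transport-joins (sym ∘ s≗) (sym ∘ t≗) ord′ simp′ ord simp j)
      tree ,
    (λ e∈ f∈ eq → rainbow e∈ f∈ (trans (χ≗ _) (trans eq (sym (χ≗ _))))) , S⊆
    where
    T′ : Subgraph (graph _ _ ord′ simp′)
    T′ = record { V = Subgraph.V T ; E = Subgraph.E T
                ; closed = λ e∈ → let a , b = Subgraph.closed T e∈ in
                    subst (_∈ _) (s≗ _) a , subst (_∈ _) (t≗ _) b }

Colourable : ∀ {n} → ℕ → Graph n → ℕ → Set
Colourable k G c = ∃[ χ ] IsRainbowColouring {G = G} {c = c} χ k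

colourable? : ∀ {n} k (G : Graph n) c → Dec (Colourable k G c)
colourable? k G c = anyFunction?
  (λ χ≗ → transport-rainbowColouring (λ _ → refl) (λ _ → refl) χ≗
    src<tgt (λ _ _ → simple) src<tgt (λ _ _ → simple))
  (λ χ → rainbowColouring? G χ k)
  where open Graph G using (src<tgt; simple)

-- `Rx≤` asks for the exact rainbow index. One colouring suffices because colourability is
-- decidable, so a least number of colours can be found below `c`.
colourable⇒Rx≤ : ∀ {n k} {G : Graph n} {c ℓ} → c ≤ ℓ → Colourable k G c → Rx≤ k G ℓ
colourable⇒Rx≤ {k = k} {G} c≤ℓ col with least (colourable? k G) col
... | r , min , r≤c = r , min , ℕ.≤-trans r≤c c≤ℓ

rx≤? : ∀ {n} k (G : Graph n) ℓ → Dec (Rx≤ k G ℓ)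
rx≤? k G ℓ = map′
  (λ (_ , r<1+ℓ , col) → colourable⇒Rx≤ (s≤s⁻¹ r<1+ℓ) col)
  (λ (r , (col , _) , r≤ℓ) → r , s≤s r≤ℓ , col)
  (ℕ.anyUpTo? (colourable? k G) (suc ℓ))

module _ (n k ℓ : ℕ) where

  Attains : ℕ → Set
  Attains m = Σ (Graph n) λ G → ConnectedGraph G × Rx≤ k G ℓ × size G ≡ m

  module _ (m : ℕ) where

    private
      Good : (s t : Fin m → Fin n) → Set
      Good s t = Σ[ ord ∈ Ordered s t ] Σ[ simp ∈ NoParallel s t ]
        ConnectedGraph (graph s t ord simp) × Rx≤ k (graph s t ord simp) ℓ

      transport-good : ∀ {s t s′ t′} → s ≗ s′ → t ≗ t′ →
        (ord′ : Ordered s′ t′) (simp′ : NoParallel s′ t′) → Good s t →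
        ConnectedGraph (graph s′ t′ ord′ simp′) × Rx≤ k (graph s′ t′ ord′ simp′) ℓ
      transport-good s≗ t≗ ord′ simp′ (ord , simp , conn , r , ((χ , rc) , _) , r≤ℓ) =
        transport-connectedGraph s≗ t≗ ord simp ord′ simp′ conn ,
        colourable⇒Rx≤ r≤ℓ
          (χ , transport-rainbowColouring s≗ t≗ (λ _ → refl) ord simp ord′ simp′ rc)

      good-resp : ∀ {s t s′ t′} → s ≗ s′ → t ≗ t′ → Good s t → Good s′ t′
      good-resp {s} {t} {s′} {t′} s≗ t≗ g@(ord , simp , _) =
        ord′ , simp′ , transport-good s≗ t≗ ord′ simp′ g
        where
        ord′ : Ordered s′ t′
        ord′ e = subst₂ Fin._<_ (s≗ e) (t≗ e) (ord e)
        simp′ : NoParallel s′ t′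
        simp′ e f p q = simp e f (trans (s≗ _) (trans p (sym (s≗ _)))) (trans (t≗ _) (trans q (sym (t≗ _))))

      good? : ∀ s t → Dec (Good s t)
      good? s t with all? (λ e → s e <? t e)
      ... | no ¬ord = no (¬ord ∘ proj₁)
      ... | yes ord with all? (λ e → all? λ f → (s e ≟ s f) →-dec (t e ≟ t f) →-dec (e ≟ f))
      ...   | no ¬simp = no (¬simp ∘ proj₁ ∘ proj₂)
      ...   | yes simp = map′ (λ c → ord , simp , c)
        (transport-good (λ _ → refl) (λ _ → refl) ord simp)
        (connected? (whole G) ×-dec rx≤? k G ℓ)
        where
        G : Graph n
        G = graph s t ord simp

    attains? : Dec (Attains m)
    attains? = map′
      (λ (s , t , ord , simp , conn , rx) → graph s t ord simp , conn , rx , refl)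
      (λ { (G , conn , rx , refl) →
        Graph.src G , Graph.tgt G , Graph.src<tgt G , (λ _ _ → Graph.simple G) , conn , rx })
      (anyFunction? (λ s≗ (t , g) → t , good-resp s≗ (λ _ → refl) g)
        λ s → anyFunction? (good-resp (λ _ → refl)) (good? s))

  attained⇒IsT : ∀ {m} → Attains m → ∃[ t ] IsT n k ℓ t × t ≤ m
  attained⇒IsT = least attains?

-- Trees grown leaf by leaf

open Subgraph using () renaming (V to vertices; E to edges)

module _ {n : ℕ} {G : Graph n} where

  joins-sym : ∀ {e u v} → Joins {G = G} e u v → Joins {G = G} e v u
  joins-sym (inj₁ p) = inj₂ p
  joins-sym (inj₂ p) = inj₁ p

  joins-unique : ∀ {e u v x y} → Joins {G = G} e u v → Joins {G = G} e x y →
    (x ≡ u × y ≡ v) ⊎ (x ≡ v × y ≡ u)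
  joins-unique (inj₁ (refl , refl)) (inj₁ (refl , refl)) = inj₁ (refl , refl)
  joins-unique (inj₁ (refl , refl)) (inj₂ (refl , refl)) = inj₂ (refl , refl)
  joins-unique (inj₂ (refl , refl)) (inj₁ (refl , refl)) = inj₂ (refl , refl)
  joins-unique (inj₂ (refl , refl)) (inj₂ (refl , refl)) = inj₁ (refl , refl)

module _ {n : ℕ} {G : Graph n} (H : Subgraph G) where

  adjacent-sym : ∀ {u v} → Adjacent H u v → Adjacent H v u
  adjacent-sym (e , e∈ , j) = e , e∈ , joins-sym {G = G} j

  adjacent⇒∈ : ∀ {u v} → Adjacent H u v → u ∈ vertices H
  adjacent⇒∈ (e , e∈ , inj₁ (refl , _)) = proj₁ (Subgraph.closed H e∈)
  adjacent⇒∈ (e , e∈ , inj₂ (_ , refl)) = proj₂ (Subgraph.closed H e∈)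

  -- These are the predecessor and the successor around the cycle, distinct because the length is at
  -- least three. The first and the last position use the closing edge.
  cycle-neighbours : (c : Cycle H) → let open Cycle c in ∀ i →
    ∃[ j ] ∃[ k ] j ≢ k × Adjacent H (vertex i) (vertex j) × Adjacent H (vertex i) (vertex k)
  cycle-neighbours c zero =
    suc zero , fromℕ _ , (λ ()) , step zero , adjacent-sym close
    where open Cycle c
  cycle-neighbours c (suc j) with suc j in eq | view (suc j)
  ... | _ | ‵fromℕ with refl ← eq =
    inject₁ j , zero , (λ ()) , adjacent-sym (step j) , close
    where open Cycle c
  ... | _ | ‵inject₁ i =
    inject₁ j , suc i , j≢1+i , subst (λ x → Adjacent H (vertex x) _) eq (adjacent-sym (step j)) , step i
    where
    open Cycle c
    j≢1+i : inject₁ j ≢ suc i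
    -- Here `suc j` is `inject₁ i`, so identifying predecessor and successor would give `toℕ i` = 2
    -- + `toℕ i`.
    j≢1+i p = ℕ.<⇒≢ (ℕ.m<n⇒m<1+n (ℕ.n<1+n (toℕ i))) (begin
      toℕ i                 ≡⟨ toℕ-inject₁ i ⟨
      toℕ (inject₁ i)       ≡⟨ cong toℕ eq ⟨
      suc (toℕ j)           ≡⟨ cong suc (toℕ-inject₁ j) ⟨
      suc (toℕ (inject₁ j)) ≡⟨ cong (suc ∘ toℕ) p ⟩
      suc (suc (toℕ i))     ∎)
      where open ≡-Reasoning

module _ {n : ℕ} {G : Graph n} {T T′ : Subgraph G} {e q u}
  (q∈V : q ∈ vertices T) (u∉V : u ∉ vertices T) (e-joins : Joins {G = G} e q u)
  (V≡ : vertices T′ ≡ ⁅ u ⁆ ∪ vertices T) (E≡ : edges T′ ≡ ⁅ e ⁆ ∪ edges T)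
  where

  private
    u≢q : u ≢ q
    u≢q refl = u∉V q∈V

    vertex-cases : ∀ {x} → x ∈ vertices T′ → x ≡ u ⊎ x ∈ vertices T
    vertex-cases x∈ with x∈p∪q⁻ ⁅ u ⁆ (vertices T) (subst (_ ∈_) V≡ x∈)
    ... | inj₁ x∈u = inj₁ (x∈⁅y⁆⇒x≡y u x∈u)
    ... | inj₂ x∈V = inj₂ x∈V

    edge-cases : ∀ {f} → f ∈ edges T′ → f ≡ e ⊎ f ∈ edges T
    edge-cases f∈ with x∈p∪q⁻ ⁅ e ⁆ (edges T) (subst (_ ∈_) E≡ f∈)
    ... | inj₁ f∈e = inj₁ (x∈⁅y⁆⇒x≡y e f∈e)
    ... | inj₂ f∈E = inj₂ f∈E

    lift : ∀ {x y} → Adjacent T x y → Adjacent T′ x y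
    lift (f , f∈ , j) = f , subst (f ∈_) (sym E≡) (x∈p∪q⁺ (inj₂ f∈)) , j

    leaf-edge : Adjacent T′ u q
    leaf-edge = e , subst (e ∈_) (sym E≡) (x∈p∪q⁺ (inj₁ (x∈⁅x⁆ e))) , joins-sym {G = G} e-joins

    joined-to-u : ∀ {x} → Joins {G = G} e u x → x ≡ q
    joined-to-u j with joins-unique {G = G} e-joins j
    ... | inj₁ (u≡q , _) = contradiction u≡q u≢q
    ... | inj₂ (_ , x≡q) = x≡q

    neighbour-of-u : ∀ {x} → Adjacent T′ u x → x ≡ q
    neighbour-of-u (f , f∈ , j) with edge-cases f∈
    ... | inj₁ refl = joined-to-u j
    ... | inj₂ f∈E  = contradiction (adjacent⇒∈ T (f , f∈E , j)) u∉V

    restrict : ∀ {x y} → x ≢ u → y ≢ u → Adjacent T′ x y → Adjacent T x y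
    restrict x≢u y≢u (f , f∈ , j) with edge-cases f∈
    ... | inj₂ f∈E  = f , f∈E , j
    ... | inj₁ refl with joins-unique {G = G} e-joins j
    ...   | inj₁ (_ , y≡u) = contradiction y≡u y≢u
    ...   | inj₂ (x≡u , _) = contradiction x≡u x≢u

    -- A vertex on a cycle has two distinct neighbours, whereas the leaf `u` has only `q`.
    avoids-u : (c : Cycle T′) → ∀ i → Cycle.vertex c i ≢ u
    avoids-u c i eq with cycle-neighbours T′ c i
    ... | j , k , j≢k , a , b = j≢k (Cycle.injective c (trans (near-q a) (sym (near-q b))))
      where
      near-q : ∀ {x} → Adjacent T′ (Cycle.vertex c i) x → x ≡ q
      near-q a = neighbour-of-u (subst (λ y → Adjacent T′ y _) eq a)

  -- Every vertex has a path to `q`, which gives connectedness. A cycle of `T′` misses `u`, so all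
  -- its edges already lie in `T`.
  add-leaf : IsTree T → IsTree T′
  add-leaf ((_ , conn) , acyclic) = ((q , ∈V′ q∈V) , conn′) , acyclic′
    where
    ∈V′ : ∀ {x} → x ∈ vertices T → x ∈ vertices T′
    ∈V′ x∈ = subst (_ ∈_) (sym V≡) (x∈p∪q⁺ (inj₂ x∈))

    to-q : ∀ {x} → x ∈ vertices T′ → Star (Adjacent T′) x q
    to-q x∈ with vertex-cases x∈
    ... | inj₁ refl = leaf-edge ◅ ε
    ... | inj₂ x∈V  = gmap (λ y → y) lift (conn x∈V q∈V)

    conn′ : ∀ {x y} → x ∈ vertices T′ → y ∈ vertices T′ → Star (Adjacent T′) x y
    conn′ x∈ y∈ = to-q x∈ ◅◅ reverse (adjacent-sym T′) (to-q y∈)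

    acyclic′ : ¬ Cycle T′
    acyclic′ c = acyclic (record
      { m = m ; vertex = vertex ; injective = injective
      ; step  = λ i → restrict (avoids-u c _) (avoids-u c _) (step i)
      ; close = restrict (avoids-u c _) (avoids-u c _) close })
      where open Cycle c

-- Construction histories of rainbow trees: a new vertex excludes cycles and a new colour keeps the
-- tree rainbow, so both properties follow by induction.
data Grown {n c} (G : Graph n) (χ : Colouring G c) : Subset n → Subset (size G) → Set where
  point : ∀ v → Grown G χ ⁅ v ⁆ ⊥
  grow  : ∀ {V E q} e u → Grown G χ V E → q ∈ V → u ∉ V → Joins {G = G} e q u →
          (∀ {f} → f ∈ E → χ f ≢ χ e) → Grown G χ (⁅ u ⁆ ∪ V) (⁅ e ⁆ ∪ E)

module _ {n c : ℕ} {G : Graph n} {χ : Colouring G c} where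
  open Graph G using (src; tgt)

  grown-closed : ∀ {V E} → Grown G χ V E → Closed G V E
  grown-closed (point v) e e∈ = contradiction e∈ ∉⊥
  grown-closed (grow {V} {E} e u t q∈V _ j _) f f∈ with x∈p∪q⁻ ⁅ e ⁆ E f∈
  ... | inj₂ f∈E = let s∈ , t∈ = grown-closed t f f∈E in
                   x∈p∪q⁺ (inj₂ s∈) , x∈p∪q⁺ (inj₂ t∈)
  ... | inj₁ f∈e with refl ← x∈⁅y⁆⇒x≡y e f∈e | j
  ...   | inj₁ (refl , refl) = x∈p∪q⁺ (inj₂ q∈V) , x∈p∪q⁺ (inj₁ (x∈⁅x⁆ _))
  ...   | inj₂ (refl , refl) = x∈p∪q⁺ (inj₁ (x∈⁅x⁆ _)) , x∈p∪q⁺ (inj₂ q∈V)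

  subgraph : ∀ {V E} → Grown G χ V E → Subgraph G
  subgraph {V} {E} t = record { V = V ; E = E ; closed = grown-closed t _ }

  grown-tree : ∀ {V E} (t : Grown G χ V E) → IsTree (subgraph t)
  grown-tree (point v) = ((v , x∈⁅x⁆ v) , conn) , acyclic
    where
    conn : ∀ {x y} → x ∈ ⁅ v ⁆ → y ∈ ⁅ v ⁆ → Star (Adjacent (subgraph (point v))) x y
    conn x∈ y∈ with refl ← x∈⁅y⁆⇒x≡y v x∈ | refl ← x∈⁅y⁆⇒x≡y v y∈ = ε

    acyclic : ¬ Cycle (subgraph (point v))
    acyclic c with _ , e∈ , _ ← Cycle.close c = ∉⊥ e∈
  grown-tree t₀@(grow _ _ t q∈V u∉V j _) =
    add-leaf {T = subgraph t} {subgraph t₀} q∈V u∉V j refl refl (grown-tree t)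

  grown-rainbow : ∀ {V E} (t : Grown G χ V E) → Rainbow χ (subgraph t)
  grown-rainbow (point v) e∈ = contradiction e∈ ∉⊥
  grown-rainbow (grow {E = E} e u t _ _ _ new) {f} {g} f∈ g∈ eq
    with x∈p∪q⁻ ⁅ e ⁆ E f∈ | x∈p∪q⁻ ⁅ e ⁆ E g∈
  ... | inj₁ f∈e | inj₁ g∈e = trans (x∈⁅y⁆⇒x≡y e f∈e) (sym (x∈⁅y⁆⇒x≡y e g∈e))
  ... | inj₁ f∈e | inj₂ g∈E with refl ← x∈⁅y⁆⇒x≡y e f∈e = contradiction (sym eq) (new g∈E)
  ... | inj₂ f∈E | inj₁ g∈e with refl ← x∈⁅y⁆⇒x≡y e g∈e = contradiction eq (new f∈E)
  ... | inj₂ f∈E | inj₂ g∈E = grown-rainbow t f∈E g∈E eq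

  Spanned : Subset n → Set
  Spanned S = ∃[ V ] ∃[ E ] Grown G χ V E × S ⊆ V

  spanned⇒sTree : ∀ {S} → Spanned S → ∃[ T ] RainbowSTree χ S T
  spanned⇒sTree (_ , _ , t , S⊆V) = subgraph t , grown-tree t , grown-rainbow t , S⊆V

-- Cardinalities of small subsets

∣⁅x⁆∪S∣≤1+∣S∣ : ∀ {n} (x : Fin n) S → ∣ ⁅ x ⁆ ∪ S ∣ ≤ suc ∣ S ∣
∣⁅x⁆∪S∣≤1+∣S∣ zero (s ∷ S) rewrite ∪-identityˡ S = s≤s (∣p∣≤∣x∷p∣ s S)
∣⁅x⁆∪S∣≤1+∣S∣ (suc x) (outside ∷ S) = ∣⁅x⁆∪S∣≤1+∣S∣ x S
∣⁅x⁆∪S∣≤1+∣S∣ (suc x) (inside  ∷ S) = s≤s (∣⁅x⁆∪S∣≤1+∣S∣ x S)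

∣S∣≤0⇒S⊆ : ∀ {n} {S S′ : Subset n} → ∣ S ∣ ≤ 0 → S ⊆ S′
∣S∣≤0⇒S⊆ {S = outside ∷ S} {_ ∷ _} ∣S∣≤0 (there x∈) = there (∣S∣≤0⇒S⊆ ∣S∣≤0 x∈)

∣S∣≤1⇒S⊆⁅x⁆ : ∀ {n} (S : Subset (suc n)) → ∣ S ∣ ≤ 1 → ∃[ x ] S ⊆ ⁅ x ⁆
∣S∣≤1⇒S⊆⁅x⁆ (inside ∷ S) ∣S∣≤1 = zero , s⊆s (∣S∣≤0⇒S⊆ (s≤s⁻¹ ∣S∣≤1))
-- An empty set is exhausted here, and the last vertex serves as the default.
∣S∣≤1⇒S⊆⁅x⁆ (outside ∷ []) _ = zero , out⊆ (λ ())
∣S∣≤1⇒S⊆⁅x⁆ (outside ∷ S@(_ ∷ _)) ∣S∣≤1 with ∣S∣≤1⇒S⊆⁅x⁆ S ∣S∣≤1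
... | x , S⊆ = suc x , out⊆ S⊆

-- Enlarging a coloured graph

addVertex : ∀ {n} → Graph n → Graph (suc n)
addVertex G = record
  { size = size G ; src = suc ∘ src ; tgt = suc ∘ tgt ; src<tgt = s≤s ∘ src<tgt
  ; simple = λ p q → simple (suc-injective p) (suc-injective q) }
  where open Graph G using (src; tgt; src<tgt; simple)

addEdge : ∀ {n} (G : Graph n) (s t : Fin n) → s Fin.< t →
  (∀ e → Graph.src G e ≡ s → Graph.tgt G e ≢ t) → Graph n
addEdge {n} G s t s<t absent = record
  { size = suc (size G) ; src = s Vector.∷ src ; tgt = t Vector.∷ tgt
  ; src<tgt = λ { zero → s<t ; (suc e) → src<tgt e }
  ; simple = λ {e} {f} → simple′ e f }
  where
  open Graph G using (src; tgt; src<tgt; simple)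
  simple′ : ∀ e f → (s Vector.∷ src) e ≡ (s Vector.∷ src) f →
    (t Vector.∷ tgt) e ≡ (t Vector.∷ tgt) f → e ≡ f
  simple′ zero    zero    p q = refl
  simple′ zero    (suc f) p q = contradiction (sym q) (absent f (sym p))
  simple′ (suc e) zero    p q = contradiction q (absent e p)
  simple′ (suc e) (suc f) p q = cong suc (simple p q)

module _ {n c : ℕ} {G : Graph n} {χ : Colouring G c} where

  grown-addVertex : ∀ {V E} → Grown G χ V E → Grown (addVertex G) χ (outside ∷ V) E
  grown-addVertex (point v) = point (suc v)
  grown-addVertex (grow e u t q∈V u∉V j new) =
    grow e (suc u) (grown-addVertex t) (there q∈V) (u∉V ∘ drop-there) (joins j) new
    where
    joins : ∀ {e u v} → Joins {G = G} e u v → Joins {G = addVertex G} e (suc u) (suc v)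
    joins (inj₁ (p , q)) = inj₁ (cong suc p , cong suc q)
    joins (inj₂ (p , q)) = inj₂ (cong suc p , cong suc q)

  grown-addEdge : ∀ {s t s<t absent k V E} → Grown G χ V E →
    Grown (addEdge G s t s<t absent) (k Vector.∷ χ) V (outside ∷ E)
  grown-addEdge (point v) = point v
  grown-addEdge (grow e u t q∈V u∉V j new) =
    grow (suc e) u (grown-addEdge t) q∈V u∉V j λ { (there f∈) → new f∈ }

  -- Applied with `suc`, this frees colour zero for new edges.
  grown-recolour : ∀ {d V E} {κ : Fin c → Fin d} → Injective _≡_ _≡_ κ →
    Grown G χ V E → Grown G (κ ∘ χ) V E
  grown-recolour inj (point v) = point v
  grown-recolour inj (grow e u t q∈V u∉V j new) =
    grow e u (grown-recolour inj t) q∈V u∉V j λ f∈ → new f∈ ∘ inj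

-- The bound is an inequality because the inductive steps replace a new vertex by an old one that
-- may already belong to the set.
SpansTriples : ∀ {n c} (G : Graph n) → Colouring G c → Set
SpansTriples G χ = ∀ S → ∣ S ∣ ≤ 3 → Spanned {G = G} {χ} S

Avoids : ∀ {n c} (G : Graph n) → Colouring G c → Fin c → Subset (size G) → Set
Avoids G χ a E = ∀ {e} → e ∈ E → χ e ≢ a

-- The invariant behind the triples {v, w, x}: the tree through x touches the spine pq and leaves
-- colour `a` free for the edge vw.
Reaches : ∀ {n c} (G : Graph n) → Colouring G c → (p q : Fin n) → Fin c → Set
Reaches G χ p q a = ∀ x → ∃[ V ] ∃[ E ]
  Grown G χ V E × Avoids G χ a E × x ∈ V × (p ∈ V ⊎ q ∈ V)

module Pendant {n c : ℕ} (G : Graph n) (χ : Colouring G c) (p : Fin n) where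

  pendant : Graph (suc n)
  pendant = addEdge (addVertex G) zero (suc p) (s≤s ℕ.z≤n) (λ _ ())

  colouring : Colouring pendant (suc c)
  colouring = zero Vector.∷ (suc ∘ χ)

  grown-old : ∀ {V E} → Grown G χ V E → Grown pendant colouring (outside ∷ V) (outside ∷ E)
  grown-old t = grown-addEdge (grown-addVertex (grown-recolour suc-injective t))

  grown-leaf : ∀ {V E} → Grown G χ V E → p ∈ V →
    Grown pendant colouring (inside ∷ V) (inside ∷ E)
  -- Adding the singleton of zero leaves a union with `⊥` in the tail, which the rewriting removes.
  grown-leaf {V} {E} t p∈V = subst₂ (Grown pendant colouring)
    (cong (inside ∷_) (∪-identityˡ V)) (cong (inside ∷_) (∪-identityˡ E))
    (grow zero zero (grown-old t) (there p∈V) (λ ()) (inj₂ (refl , refl)) λ { (there _) () })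

  -- A set containing the leaf is reduced to old vertices by putting `p` in its place; the tree
  -- found contains `p`, so the leaf can be attached.
  spansTriples : SpansTriples G χ → SpansTriples pendant colouring
  spansTriples spans (outside ∷ S) ∣S∣≤3 with spans S ∣S∣≤3
  ... | _ , _ , t , S⊆V = _ , _ , grown-old t , s⊆s S⊆V
  spansTriples spans (inside ∷ S) ∣S∣≤2
    with spans (⁅ p ⁆ ∪ S) (ℕ.≤-trans (∣⁅x⁆∪S∣≤1+∣S∣ p S) ∣S∣≤2)
  ... | _ , _ , t , S⊆V =
    _ , _ , grown-leaf t (S⊆V (x∈p∪q⁺ (inj₁ (x∈⁅x⁆ p)))) , s⊆s (S⊆V ∘ x∈p∪q⁺ ∘ inj₂)

-- The new vertices are w = 0, joined to q and v, and v = 1, joined to p and w.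
module Page {n c : ℕ} (G : Graph (suc n)) (χ : Colouring G c) (p q : Fin (suc n)) (a : Fin c) where

  open Pendant G χ p

  private
    G₁ : Graph (3 + n)
    G₁ = addEdge (addVertex pendant) zero (suc zero) (s≤s ℕ.z≤n) (λ _ ())

  page : Graph (3 + n)
  page = addEdge G₁ zero (suc (suc q)) (s≤s ℕ.z≤n) (λ { zero _ () ; (suc _) () })

  -- The edges are listed as wq, wv, vp and then those of `G`. Both wq and vp carry the new colour
  -- zero, while wv repeats `a`, now shifted to `suc a`.
  colouring′ : Colouring page (suc c)
  colouring′ = zero Vector.∷ (suc a Vector.∷ colouring)

  grown-pendant : ∀ {V E} → Grown pendant colouring V E →
    Grown page colouring′ (outside ∷ V) (outside ∷ outside ∷ E)
  grown-pendant t = grown-addEdge (grown-addEdge (grown-addVertex t))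

  grown-w : ∀ {V E} → Grown G χ V E → q ∈ V →
    Grown page colouring′ (inside ∷ outside ∷ V) (inside ∷ outside ∷ outside ∷ E)
  grown-w {V} {E} t q∈V = subst₂ (Grown page colouring′)
    (cong (λ X → inside ∷ outside ∷ X) (∪-identityˡ V))
    (cong (λ X → inside ∷ outside ∷ outside ∷ X) (∪-identityˡ E))
    (grow zero zero (grown-pendant (grown-old t)) (there (there q∈V)) (λ ())
      (inj₂ (refl , refl)) λ { (there (there (there _))) () })

  -- From `p` the tree grows to v and then w, from `q` to w and then v. Either way only one edge of
  -- colour zero is used, and wv comes last with a colour that the old tree avoids.
  grown-wv : ∀ {V E} → Grown G χ V E → Avoids G χ a E → p ∈ V ⊎ q ∈ V →
    ∃[ E′ ] Grown page colouring′ (inside ∷ inside ∷ V) E′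
  grown-wv {V} {E} t avoids (inj₁ p∈V) = _ ,
    subst (λ X → Grown page colouring′ (inside ∷ inside ∷ X) _) (∪-identityˡ V)
    (grow (suc zero) zero (grown-pendant (grown-leaf t p∈V)) (there here) (λ ()) (inj₂ (refl , refl))
      λ { (there (there here)) ()
        ; (there (there (there f∈))) → avoids f∈ ∘ suc-injective })
  grown-wv {V} {E} t avoids (inj₂ q∈V) = _ ,
    subst (λ X → Grown page colouring′ (inside ∷ inside ∷ X) _) (∪-identityˡ V)
    (grow (suc zero) (suc zero) (grown-w t q∈V) here (λ { (there ()) }) (inj₁ (refl , refl))
      λ { here ()
        ; (there (there (there f∈))) → avoids f∈ ∘ suc-injective })

  -- Without w the page acts as a pendant edge at `p`; with w but not v, `q` stands in for w. With
  -- both, at most one old vertex x remains, and `reaches` supplies its tree.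
  spansTriples′ : Reaches G χ p q a → SpansTriples G χ → SpansTriples page colouring′
  spansTriples′ reaches spans (outside ∷ S) ∣S∣≤3 with spansTriples spans S ∣S∣≤3
  ... | _ , _ , t , S⊆V = _ , _ , grown-pendant t , s⊆s S⊆V
  spansTriples′ reaches spans (inside ∷ outside ∷ S) ∣S∣≤2
    with spans (⁅ q ⁆ ∪ S) (ℕ.≤-trans (∣⁅x⁆∪S∣≤1+∣S∣ q S) ∣S∣≤2)
  ... | _ , _ , t , S⊆V =
    _ , _ , grown-w t (S⊆V (x∈p∪q⁺ (inj₁ (x∈⁅x⁆ q)))) ,
    s⊆s (s⊆s (S⊆V ∘ x∈p∪q⁺ ∘ inj₂))
  spansTriples′ reaches spans (inside ∷ inside ∷ S) ∣S∣≤1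
    with x , S⊆x ← ∣S∣≤1⇒S⊆⁅x⁆ S (s≤s⁻¹ (s≤s⁻¹ ∣S∣≤1))
    with V , _ , t , avoids , x∈V , pq∈V ← reaches x =
    _ , _ , proj₂ (grown-wv t avoids pq∈V) , s⊆s (s⊆s S⊆V)
    where
    S⊆V : S ⊆ V
    S⊆V y∈ with refl ← x∈⁅y⁆⇒x≡y x (S⊆x y∈) = x∈V

  -- The new vertices reach the spine along wq and pv, whose colour zero differs from `suc a`; old
  -- vertices keep their trees.
  reaches′ : Reaches G χ p q a → Reaches page colouring′ (suc (suc p)) (suc (suc q)) (suc a)
  reaches′ reaches zero =
    _ , _ , grown-w (point q) (x∈⁅x⁆ q) ,
    (λ { here () ; (there (there (there e∈))) → contradiction e∈ ∉⊥ }) ,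
    here , inj₂ (there (there (x∈⁅x⁆ q)))
  reaches′ reaches (suc zero) =
    _ , _ , grown-pendant (grown-leaf (point p) (x∈⁅x⁆ p)) ,
    (λ { (there (there here)) () ; (there (there (there e∈))) → contradiction e∈ ∉⊥ }) ,
    there here , inj₁ (there (there (x∈⁅x⁆ p)))
  reaches′ reaches (suc (suc x)) with reaches x
  ... | _ , _ , t , avoids , x∈V , pq∈V =
    _ , _ , grown-pendant (grown-old t) ,
    (λ { (there (there (there e∈))) → avoids e∈ ∘ suc-injective }) ,
    there (there x∈V) , map⊎ (there ∘ there) (there ∘ there) pq∈V

-- Books: four-cycles sharing one edge

record Book (j : ℕ) : Set where
  field
    G       : Graph (suc j * 2)
    χ       : Colouring G (suc j)
    size≡   : size G ≡ 1 + j * 3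
    p q     : Fin (suc j * 2)
    a       : Fin (suc j)
    spans   : SpansTriples G χ
    reaches : Reaches G χ p q a

-- The start is the single edge pq, obtained as a pendant edge at a one-vertex graph. Each page then
-- adds two vertices, three edges and one colour.
book : ∀ j → Book j
book zero = record
  { G = pendant ; χ = colouring ; size≡ = refl ; p = zero ; q = suc zero ; a = zero
  ; spans = spansTriples (λ S _ → _ , _ , point zero , λ { {zero} _ → here })
  ; reaches = λ
      -- Both vertices lie on the spine, so trees without edges avoid `a` trivially.
      { zero       → _ , _ , point zero , (λ e∈ → contradiction e∈ ∉⊥) , here , inj₁ here
      ; (suc zero) → _ , _ , point (suc zero) , (λ e∈ → contradiction e∈ ∉⊥) ,
                     there here , inj₂ (there here) } }
  where
  K₁ : Graph 1
  K₁ = record { size = 0 ; src = λ () ; tgt = λ () ; src<tgt = λ () ; simple = λ { {()} } }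
  open Pendant {c = 0} K₁ (λ ()) zero
book (suc j) = record
  { G = page ; χ = colouring′ ; size≡ = cong (3 +_) size≡
  ; p = suc (suc p) ; q = suc (suc q) ; a = suc a
  ; spans = spansTriples′ reaches spans ; reaches = reaches′ reaches }
  where
  open Book (book j)
  open Page G χ p q a

-- From books to the bound

TripleSpanned : (n c m : ℕ) → Set
TripleSpanned n c m =
  Σ[ G ∈ Graph n ] Σ[ χ ∈ Colouring G c ] size G ≡ m × SpansTriples G χ

addPendants : ∀ {n c m} d → 1 ≤ n → TripleSpanned n c m → TripleSpanned (d + n) (d + c) (d + m)
addPendants zero    _   g = g
addPendants {n} (suc d) 1≤n g with addPendants d 1≤n g
... | G , χ , size≡ , spans = pendant , colouring , cong suc size≡ , spansTriples spans
  -- The edge hangs at vertex zero, which after the first round is the vertex added last, so the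
  -- added edges form a path.
  where open Pendant G χ (fromℕ< (ℕ.≤-trans 1≤n (ℕ.m≤n+m n d)))

-- A pair of vertices has size at most three, so some tree contains both, and its path between them
-- lies in the graph.
spansTriples⇒connected : ∀ {n c} {G : Graph n} {χ : Colouring G c} → 1 ≤ n →
  SpansTriples G χ → ConnectedGraph G
spansTriples⇒connected {n} {G = G} {χ} 1≤n spans =
  (fromℕ< 1≤n , ∈⊤) , λ {u} {v} _ _ → path u v
  where
  path : ∀ u v → Star (Adjacent (whole G)) u v
  path u v with spans (⁅ u ⁆ ∪ ⁅ v ⁆) (ℕ.≤-trans (∣⁅x⁆∪S∣≤1+∣S∣ u ⁅ v ⁆)
                  (s≤s (ℕ.≤-trans (ℕ.≤-reflexive (∣⁅x⁆∣≡1 v)) (s≤s ℕ.z≤n))))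
  ... | _ , _ , t , ⊆V = gmap (λ x → x) (λ (e , _ , j) → e , ∈⊤ , j)
    (proj₂ (proj₁ (grown-tree t))
      (⊆V (x∈p∪q⁺ (inj₁ (x∈⁅x⁆ u)))) (⊆V (x∈p∪q⁺ (inj₂ (x∈⁅x⁆ v)))))

tripleSpanned⇒attains : ∀ {n c m} → 1 ≤ n → TripleSpanned n c m → Attains n 3 c m
tripleSpanned⇒attains 1≤n (G , χ , size≡ , spans) =
  G , spansTriples⇒connected 1≤n spans ,
  colourable⇒Rx≤ ℕ.≤-refl
    (χ , λ S ∣S∣≡3 → spanned⇒sTree (spans S (ℕ.≤-reflexive ∣S∣≡3))) ,
  size≡

bookWithPendants : ∀ j d → TripleSpanned (d + suc j * 2) (d + suc j) (d + (1 + j * 3))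
bookWithPendants j d = addPendants d (s≤s ℕ.z≤n) (G , χ , size≡ , spans)
  where open Book (book j)

-- With n = d + 2(j + 1) and ℓ = d + j + 1 the size equals 2n - ℓ - 2, one less than the bound; `eq`
-- is this identity without subtraction.
size-bound : ∀ j d → d + (1 + j * 3) ≤ 2 * (d + suc j * 2) ∸ (d + suc j) ∸ 1
size-bound j d = begin
  d + (1 + j * 3)                                   ≤⟨ ℕ.n≤1+n _ ⟩
  suc (suc (d + (1 + j * 3))) ∸ 1                   ≡⟨ cong (_∸ 1) (ℕ.m+n∸m≡n (d + suc j) _) ⟨
  d + suc j + suc (suc (d + (1 + j * 3))) ∸ (d + suc j) ∸ 1
                                                    ≡⟨ cong (λ x → x ∸ (d + suc j) ∸ 1) (eq j d) ⟩
  2 * (d + suc j * 2) ∸ (d + suc j) ∸ 1             ∎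
  where
  open ℕ.≤-Reasoning
  eq : ∀ j d → d + suc j + suc (suc (d + (1 + j * 3))) ≡ 2 * (d + suc j * 2)
  eq = solve-∀

book-bound : ∀ j d → let n = d + suc j * 2 ; ℓ = d + suc j in
  ∃[ t ] IsT n 3 ℓ t × t ≤ 2 * n ∸ ℓ ∸ 1
book-bound j d = t , isT , ℕ.≤-trans t≤ (size-bound j d)
  where
  minimum : ∃[ t ] IsT (d + suc j * 2) 3 (d + suc j) t × t ≤ d + (1 + j * 3)
  minimum = attained⇒IsT _ _ _
    (tripleSpanned⇒attains (ℕ.m≤n⇒m≤o+n d (s≤s ℕ.z≤n)) (bookWithPendants j d))
  t   = proj₁ minimum
  isT = proj₁ (proj₂ minimum)
  t≤  = proj₂ (proj₂ minimum)

order≡ : ∀ o d → d + (3 + o) * 2 ≡ 3 + o + d + 3 + o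
order≡ = solve-∀

palette≡ : ∀ o d → d + (3 + o) ≡ 3 + o + d
palette≡ = solve-∀

theorem2p12 : (n ℓ : ℕ) → 1 ≤ n → 1 ≤ ℓ → n ≤ 2 * ℓ → ℓ + 3 ≤ n →
    ∃[ t ] IsT n 3 ℓ t × t ≤ 2 * n ∸ ℓ ∸ 1
theorem2p12 n ℓ 1≤n _ n≤2ℓ ℓ+3≤n
  -- This makes n - ℓ equal to 3 + `o`.
  with o , refl ← ℕ.m≤n⇒∃[o]m+o≡n ℓ+3≤n
  -- Cancelling one ℓ in n ≤ 2ℓ leaves 3 + `o` ≤ ℓ; the difference `d` is the number of pendant
  -- edges.
  with d , refl ← ℕ.m≤n⇒∃[o]m+o≡n {3 + o} {ℓ} (ℕ.+-cancelˡ-≤ ℓ _ _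
         (subst₂ _≤_ (ℕ.+-assoc ℓ 3 o) (cong (ℓ +_) (ℕ.+-identityʳ ℓ)) n≤2ℓ))
  -- The book has n - ℓ - 1 = 2 + `o` pages and hence 3 + `o` colours, to which the pendant edges
  -- add `d`.
  = subst₂ (λ n ℓ → ∃[ t ] IsT n 3 ℓ t × t ≤ 2 * n ∸ ℓ ∸ 1) (order≡ o d) (palette≡ o d)
      (book-bound (2 + o) d)
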